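{- For every integer $t\ge 1$, if a graph $G$ is $tP_1$-pivot-unique, then $|V(G)|\le 2^t-1$.
   Context: Graphs are finite, without loops or multiple edges. $tP_1$ is the graph with $t$ vertices and no edges. For a vertex $u$ of a graph $G$, the local complementation $G*u$ is obtained from $G$ by complementing the adjacency between every pair of distinct neighbours of $u$. For an edge $uv$ of $G$, the edge pivot is $G\wedge uv=((G*u)*v)*u$. A graph $G$ contains $H$ as a pivot-minor if $H$ can be obtained from $G$ by a sequence of vertex deletions and edge pivots. Two graphs are pivot-equivalent if one can be obtained from the other by a sequence of edge pivots. For a vertex $v$ of $G$, write $G/v$ for $(G\wedge zv)-v$, where $z$ is a neighbour of $v$, and $G/v=G-v$ if $v$ is isolated; the choice of $z$ does not affect $G/v$ up to pivot-equivalence. For a graph $H$, a graph $G$ is $H$-pivot-unique if $G$ contains a pivot-minor isomorphic to $H$ and, for every vertex $v$ of $G$, at most one of $G-v$ and $G/v$ contains a pivot-minor isomorphic to $H$. -}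

module Defs where

open import Data.Bool.Base using (Bool; false; T; not; _∧_; _xor_)
open import Data.Bool.Properties using (T?; ∧-comm)
open import Data.Fin.Base using (Fin; punchIn)
open import Data.Fin.Properties using (_≟_; any?)
open import Data.Nat.Base using (ℕ; suc; pred)
open import Data.Product.Base using (Σ; ∃; _×_; _,_)
open import Function.Bundles using (_↔_; Inverse)
open import Relation.Binary.PropositionalEquality
  using (_≡_; refl; sym; cong₂)
open import Relation.Nullary using (¬_; yes; no; does; contradiction)

record Graph (n : ℕ) : Set where
  field
    adj        : Fin n → Fin n → Bool
    adj-sym    : ∀ x y → adj x y ≡ adj y x
    adj-irrefl : ∀ x → adj x x ≡ false

open Graph public

record _≅_ {m n : ℕ} (G : Graph m) (H : Graph n) : Set where
  field
    bijection : Fin m ↔ Fin n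
    preserves : ∀ x y →
      adj G x y ≡ adj H (Inverse.to bijection x) (Inverse.to bijection y)

_P₁ : (t : ℕ) → Graph t
t P₁ = record
  { adj        = λ _ _ → false
  ; adj-sym    = λ _ _ → refl
  ; adj-irrefl = λ _ → refl
  }

infixl 6 _*_ _-_ _/_

private
  variable
    n : ℕ

distinct : Fin n → Fin n → Bool
distinct x y = not (does (x ≟ y))

distinct-sym : (x y : Fin n) → distinct x y ≡ distinct y x
distinct-sym x y with x ≟ y | y ≟ x
... | yes _ | yes _ = refl
... | no  _ | no  _ = refl
... | yes p | no ¬q = contradiction (sym p) ¬q
... | no ¬p | yes q = contradiction (sym q) ¬p

distinct-irrefl : (x : Fin n) → distinct x x ≡ false
distinct-irrefl x with x ≟ x
... | yes _ = refl
... | no ¬p = contradiction refl ¬p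

_*_ : Graph n → Fin n → Graph n
G * u = record
  { adj        = λ x y → adj G x y xor (distinct x y ∧ (adj G u x ∧ adj G u y))
  ; adj-sym    = λ x y → cong₂ _xor_ (adj-sym G x y)
      (cong₂ _∧_ (distinct-sym x y) (∧-comm (adj G u x) (adj G u y)))
  ; adj-irrefl = λ x → cong₂ (λ a d → a xor (d ∧ (adj G u x ∧ adj G u x)))
      (adj-irrefl G x) (distinct-irrefl x)
  }

-- Defined for all u and v, but only ever used below when uv is an edge.
pivot : Graph n → Fin n → Fin n → Graph n
pivot G u v = ((G * u) * v) * u

-- The remaining vertices are renumbered, keeping their order.
_-_ : Graph n → Fin n → Graph (pred n)
_-_ {suc n} G v = record
  { adj        = λ x y → adj G (punchIn v x) (punchIn v y)
  ; adj-sym    = λ x y → adj-sym G (punchIn v x) (punchIn v y)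
  ; adj-irrefl = λ x → adj-irrefl G (punchIn v x)
  }

-- The neighbour z of v chosen here is the one with the least index; another
-- choice would give a pivot-equivalent graph.
_/_ : Graph n → Fin n → Graph (pred n)
G / v with any? (λ z → T? (adj G z v))
... | yes (z , _) = pivot G z v - v
... | no  _       = G - v

data _IsPivotMinorOf_ {m : ℕ} (H : Graph m) : {n : ℕ} → Graph n → Set where
  done    : H IsPivotMinorOf H
  delete  : {n : ℕ} {G : Graph n} (v : Fin n) →
            H IsPivotMinorOf (G - v) → H IsPivotMinorOf G
  pivotOn : {n : ℕ} {G : Graph n} (u v : Fin n) → T (adj G u v) →
            H IsPivotMinorOf (pivot G u v) → H IsPivotMinorOf G

_ContainsPivotMinor_ : {n m : ℕ} → Graph n → Graph m → Set
G ContainsPivotMinor H =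
  ∃ λ k → Σ (Graph k) λ K → K IsPivotMinorOf G × K ≅ H

_-PivotUnique_ : {m n : ℕ} → Graph m → Graph n → Set
H -PivotUnique G =
  G ContainsPivotMinor H ×
  (∀ v → ¬ ((G - v) ContainsPivotMinor H × (G / v) ContainsPivotMinor H))

-- Let A be the adjacency matrix of G over the field with two elements, and
-- L = {(x , A x)}. A pivot on uv exchanges the two coordinates of L at u and at
-- v, deleting v restricts L to x_v = 0, and contracting v (passing to G / v)
-- restricts it to (A x)_v = 0. Hence a tP₁ pivot-minor amounts to a choice of
-- t surviving vertices and of one coordinate at every vertex, such that a vector
-- of L whose chosen coordinates vanish at the other vertices has all its chosen
-- coordinates zero. Pivot-uniqueness says that no vertex is deleted by one such
-- choice and contracted by another, a condition invariant under pivots; so one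
-- may assume that G has an independent set X of size t.
--
-- Every v outside X is deleted in the choice given by X. It could be contracted
-- instead if it had no neighbour in X, if it had exactly one, or if some other
-- vertex w outside X had the same neighbours in X. So sending v to N(v) ∩ X, and
-- each element of X to its singleton, is an injection of V(G) into the nonempty
-- subsets of X.
module Submission where

open import Algebra.Bundles using (CommutativeRing)
open import Data.Bool.Base using (Bool; true; false; T; not; _∧_; _∨_; _xor_; if_then_else_)
open import Data.Bool.Properties
  using (T-≡; T?; xor-∧-commutativeRing; xor-identityʳ; xor-same; xor-comm; ∧-zeroʳ; ∧-identityʳ;
         ∧-comm; ∧-assoc; ∧-distribˡ-xor; ∧-distribʳ-xor; ¬-not)
open import Data.Bool.Solver using (module xor-∧-Solver)
open import Data.Fin.Base using (Fin; zero; suc; punchIn; punchOut; funToFin; finToFun)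
open import Data.Fin.Properties
  using (_≟_; punchInᵢ≢i; punchIn-injective; punchOut-injective; punchIn-punchOut;
         any?; all?; ¬∀⟶∃¬; injective⇒≤; finToFun-funToFin; 2↔Bool)
open import Data.Nat.Base using (ℕ; zero; suc; _≤_; _^_; _∸_)
open import Data.Nat.Properties using (∸-monoˡ-≤)
open import Data.Product.Base using (Σ; ∃; _×_; _,_; proj₁; proj₂)
open import Data.Vec.Functional using (insertAt)
open import Data.Vec.Functional.Properties using (insertAt-lookup; insertAt-punchIn)
open import Function.Base using (_∘_)
open import Function.Bundles using (Equivalence; Inverse; mk↔ₛ′; mk⇔)
open import Relation.Binary.PropositionalEquality
open import Relation.Nullary using (¬_; Dec; yes; no; does; contradiction)
open import Relation.Nullary.Decidable using (dec-true; dec-false; does-⇔)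

open import Algebra.Properties.Semiring.Sum
  (CommutativeRing.semiring xor-∧-commutativeRing)
  using (sum; sum-cong-≗; sum-remove; sum-replicate-zero; ∑-distrib-+; *-distribˡ-sum)
open import Defs

open ≡-Reasoning

private
  variable
    m n t : ℕ

-- Sums over the field with two elements

xor-twice : ∀ a b → a ≡ (a xor b) xor b
xor-twice = solve 2 (λ a b → a := (a :+ b) :+ b) refl
  where open xor-∧-Solver

sum-zero : (f : Fin n → Bool) → (∀ i → f i ≡ false) → sum f ≡ false
sum-zero {n} f f≗0 = trans (sum-cong-≗ f≗0) (sum-replicate-zero n)

sum-single : (f : Fin n → Bool) (i : Fin n) →
             (∀ j → i ≢ j → f j ≡ false) → sum f ≡ f i
sum-single {suc n} f i f≗0 = begin
  sum f                           ≡⟨ sum-remove {i = i} f ⟩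
  f i xor sum (f ∘ punchIn i)     ≡⟨ cong (f i xor_) (sum-zero _ λ j → f≗0 _ (punchInᵢ≢i i j ∘ sym)) ⟩
  f i xor false                   ≡⟨ xor-identityʳ (f i) ⟩
  f i                             ∎

δ : Fin n → Fin n → Bool
δ i j = does (i ≟ j)

δ-refl : (i : Fin n) → δ i i ≡ true
δ-refl i = dec-true (i ≟ i) refl

δ-≢ : {i j : Fin n} → i ≢ j → δ i j ≡ false
δ-≢ {i = i} {j} = dec-false (i ≟ j)

infix 8 _∙_

_∙_ : (f x : Fin n → Bool) → Bool
f ∙ x = sum (λ i → f i ∧ x i)

∙-δ : (f : Fin n → Bool) (i : Fin n) → f ∙ δ i ≡ f i
∙-δ f i = begin
  f ∙ δ i      ≡⟨ sum-single _ i (λ j i≢j → trans (cong (f j ∧_) (δ-≢ i≢j)) (∧-zeroʳ (f j))) ⟩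
  f i ∧ δ i i  ≡⟨ cong (f i ∧_) (δ-refl i) ⟩
  f i ∧ true   ≡⟨ ∧-identityʳ (f i) ⟩
  f i          ∎

sum-pair : (f : Fin n → Bool) {i j : Fin n} → i ≢ j →
           (∀ k → i ≢ k → j ≢ k → f k ≡ false) → sum f ≡ f i xor f j
sum-pair f {i} {j} i≢j f≗0 = begin
  sum f                                                ≡⟨ sum-cong-≗ split ⟩
  sum (λ k → (f k ∧ δ i k) xor (f k ∧ δ j k))          ≡⟨ ∑-distrib-+ (λ k → f k ∧ δ i k) (λ k → f k ∧ δ j k) ⟩
  f ∙ δ i xor f ∙ δ j                                  ≡⟨ cong₂ _xor_ (∙-δ f i) (∙-δ f j) ⟩
  f i xor f j                                          ∎
  where
  split : ∀ k → f k ≡ (f k ∧ δ i k) xor (f k ∧ δ j k)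
  split k with i ≟ k | j ≟ k
  ... | yes refl | yes refl = contradiction refl i≢j
  ... | yes _    | no  _    = sym (trans (cong₂ _xor_ (∧-identityʳ (f k)) (∧-zeroʳ (f k))) (xor-identityʳ (f k)))
  ... | no  _    | yes _    = sym (cong₂ _xor_ (∧-zeroʳ (f k)) (∧-identityʳ (f k)))
  ... | no  i≢k  | no  j≢k  = trans (f≗0 k i≢k j≢k) (sym (cong₂ _xor_ (∧-zeroʳ (f k)) (∧-zeroʳ (f k))))

∙-congˡ : {f g : Fin n → Bool} (x : Fin n → Bool) → f ≗ g → f ∙ x ≡ g ∙ x
∙-congˡ x f≗g = sum-cong-≗ (λ i → cong (_∧ x i) (f≗g i))

∙-distribˡ : (f x y : Fin n → Bool) → f ∙ (λ i → x i xor y i) ≡ f ∙ x xor f ∙ y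
∙-distribˡ f x y = trans (sum-cong-≗ (λ i → ∧-distribˡ-xor (f i) (x i) (y i)))
                         (∑-distrib-+ (λ i → f i ∧ x i) (λ i → f i ∧ y i))

∙-distribʳ : (x f g : Fin n → Bool) → (λ i → f i xor g i) ∙ x ≡ f ∙ x xor g ∙ x
∙-distribʳ x f g = trans (sum-cong-≗ (λ i → ∧-distribʳ-xor (x i) (f i) (g i)))
                         (∑-distrib-+ (λ i → f i ∧ x i) (λ i → g i ∧ x i))

∙-scaleˡ : (c : Bool) (f x : Fin n → Bool) → (λ i → c ∧ f i) ∙ x ≡ c ∧ f ∙ x
∙-scaleˡ c f x = trans (sum-cong-≗ (λ i → ∧-assoc c (f i) (x i)))
                       (sym (*-distribˡ-sum c (λ i → f i ∧ x i)))

∙-comm : (f x : Fin n → Bool) → f ∙ x ≡ x ∙ f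
∙-comm f x = sum-cong-≗ (λ i → ∧-comm (f i) (x i))

∙-scaleʳ : (c : Bool) (f x : Fin n → Bool) → f ∙ (λ i → c ∧ x i) ≡ c ∧ f ∙ x
∙-scaleʳ c f x = begin
  f ∙ (λ i → c ∧ x i) ≡⟨ ∙-comm f (λ i → c ∧ x i) ⟩
  (λ i → c ∧ x i) ∙ f ≡⟨ ∙-scaleˡ c x f ⟩
  c ∧ x ∙ f           ≡⟨ cong (c ∧_) (∙-comm x f) ⟩
  c ∧ f ∙ x           ∎

-- Pivoting as a principal pivot transform

-- With A and A′ the adjacency matrices of G and H over the field with two
-- elements, A′ = A + p qᵀ + q pᵀ, where p and q are the closed neighbourhoods of u and v.
record PivotRelated (G H : Graph n) (u v : Fin n) : Set where
  field
    u≢v     : u ≢ v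
    p q     : Fin n → Bool
    entries : ∀ x y → adj H x y ≡ adj G x y xor ((p x ∧ q y) xor (q x ∧ p y))
    rowᴳ-u  : ∀ x → adj G u x ≡ p x xor δ u x
    rowᴳ-v  : ∀ x → adj G v x ≡ q x xor δ v x
    rowᴴ-u  : ∀ x → adj H u x ≡ q x xor δ u x
    rowᴴ-v  : ∀ x → adj H v x ≡ p x xor δ v x

-- Pivoting twice on the same edge is the identity: the correction p qᵀ + q pᵀ is symmetric in p and
-- q and cancels when added twice. The pivot swaps the closed neighbourhoods of u and v, hence the
-- swap of `p` and `q`.
PivotRelated-sym : {G H : Graph n} {u v : Fin n} →
                   PivotRelated G H u v → PivotRelated H G u v
PivotRelated-sym {G = G} {H} r = record
  { u≢v = u≢v ; p = q ; q = p
  ; entries = λ x y → trans (cancel (adj G x y) (p x ∧ q y) (q x ∧ p y))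
                        (cong (_xor ((q x ∧ p y) xor (p x ∧ q y))) (sym (entries x y)))
  ; rowᴳ-u = rowᴴ-u ; rowᴳ-v = rowᴴ-v ; rowᴴ-u = rowᴳ-u ; rowᴴ-v = rowᴳ-v
  }
  where
  open PivotRelated r
  cancel : ∀ a b c → a ≡ (a xor (b xor c)) xor (c xor b)
  cancel = solve 3 (λ a b c → a := (a :+ (b :+ c)) :+ (c :+ b)) refl
    where open xor-∧-Solver

edge⇒≢ : (G : Graph n) {u v : Fin n} → adj G u v ≡ true → u ≢ v
edge⇒≢ G uv refl with () ← trans (sym uv) (adj-irrefl G _)

pivotRelated : (G : Graph n) (u v : Fin n) → adj G u v ≡ true →
               PivotRelated G (pivot G u v) u v
pivotRelated {n} G u v uv = record
  { u≢v = u≢v ; p = p ; q = q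
  ; entries = entries
  ; rowᴳ-u = row₀-u
  ; rowᴳ-v = λ x → xor-twice (adj G v x) (δ v x)
  ; rowᴴ-u = λ x → begin
      adj H u x                                       ≡⟨ entries u x ⟩
      adj G u x xor ((p u ∧ q x) xor (q u ∧ p x))     ≡⟨ cong₂ (λ c d → adj G u x xor ((c ∧ q x) xor (d ∧ p x))) pu qu ⟩
      adj G u x xor (q x xor p x)                     ≡⟨ row-u (adj G u x) (q x) (δ u x) ⟩
      q x xor δ u x                                   ∎
  ; rowᴴ-v = λ x → begin
      adj H v x                                       ≡⟨ entries v x ⟩
      adj G v x xor ((p v ∧ q x) xor (q v ∧ p x))     ≡⟨ cong₂ (λ c d → adj G v x xor ((c ∧ q x) xor (d ∧ p x))) pv qv ⟩
      adj G v x xor (q x xor p x)                     ≡⟨ row-v (adj G v x) (p x) (δ v x) ⟩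
      p x xor δ v x                                   ∎
  }
  where
  open xor-∧-Solver
  H = pivot G u v
  p q : Fin n → Bool
  p x = adj G u x xor δ u x
  q x = adj G v x xor δ v x

  row-u : ∀ a b d → a xor (b xor (a xor d)) ≡ b xor d
  row-u = solve 3 (λ a b d → a :+ (b :+ (a :+ d)) := b :+ d) refl
  row-v : ∀ a b d → a xor ((a xor d) xor b) ≡ b xor d
  row-v = solve 3 (λ a b d → a :+ ((a :+ d) :+ b) := b :+ d) refl

  u≢v : u ≢ v
  u≢v = edge⇒≢ G uv
  vu : adj G v u ≡ true
  vu = trans (adj-sym G v u) uv
  pu : p u ≡ true
  pu = cong₂ _xor_ (adj-irrefl G u) (δ-refl u)
  pv : p v ≡ true
  pv = cong₂ _xor_ uv (δ-≢ u≢v)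
  qu : q u ≡ true
  qu = cong₂ _xor_ vu (δ-≢ (u≢v ∘ sym))
  qv : q v ≡ true
  qv = cong₂ _xor_ (adj-irrefl G v) (δ-refl v)

  row₀-u : ∀ x → adj G u x ≡ p x xor δ u x
  row₀-u x = xor-twice (adj G u x) (δ u x)

  -- The rows along which the three local complementations act are those of u
  -- in G, of v in G * u, and of u in (G * u) * v.
  row₁-u : ∀ x → adj (G * u) u x ≡ adj G u x
  row₁-u x = begin
    adj G u x xor (distinct u x ∧ (adj G u u ∧ adj G u x)) ≡⟨ cong (λ a → adj G u x xor (distinct u x ∧ (a ∧ adj G u x))) (adj-irrefl G u) ⟩
    adj G u x xor (distinct u x ∧ false)                   ≡⟨ cong (adj G u x xor_) (∧-zeroʳ (distinct u x)) ⟩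
    adj G u x xor false                                    ≡⟨ xor-identityʳ (adj G u x) ⟩
    adj G u x                                              ∎

  row₁-v : ∀ x → adj (G * u) v x ≡ (p x xor q x) xor δ u x
  row₁-v x with v ≟ x
  ... | yes refl rewrite adj-irrefl G v | uv | δ-≢ u≢v = refl
  ... | no v≢x rewrite uv =
    solve 3 (λ a b d → b :+ a := ((a :+ d) :+ (b :+ con false)) :+ d) refl
      (adj G u x) (adj G v x) (δ u x)

  row₂-u : ∀ x → adj ((G * u) * v) u x ≡ q x xor δ u x
  row₂-u x = begin
    adj (G * u) u x xor (distinct u x ∧ (adj (G * u) v u ∧ adj (G * u) v x))
      ≡⟨ cong₂ _xor_ (row₁-u x) (cong (distinct u x ∧_)
           (cong₂ _∧_ (trans (adj-sym (G * u) v u) (trans (row₁-u v) uv)) (row₁-v x))) ⟩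
    adj G u x xor (distinct u x ∧ ((p x xor q x) xor δ u x))                 ≡⟨ step ⟩
    q x xor δ u x                                                            ∎
    where
    step : adj G u x xor (distinct u x ∧ ((p x xor q x) xor δ u x)) ≡ q x xor δ u x
    step with u ≟ x
    ... | yes refl rewrite adj-irrefl G u | vu | δ-≢ (u≢v ∘ sym) = refl
    ... | no  _    = solve 2 (λ a b → a :+ (((a :+ con false) :+ b) :+ con false) := b :+ con false) refl
                       (adj G u x) (q x)

  both-u : ∀ {x y} → x ≢ y → δ u x ∧ δ u y ≡ false
  both-u {x} {y} x≢y with u ≟ x | u ≟ y
  ... | yes refl | yes refl = contradiction refl x≢y
  ... | yes _    | no  _    = refl
  ... | no  _    | _        = refl

  -- Off the diagonal, each of the three local complementations adds the product of its acting row
  -- at x and at y. The products sum to the correction up to `d ∧ d′`, that is `δ u x ∧ δ u y`,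
  -- which is zero when x and y differ.
  expand : ∀ A p q d p′ q′ d′ →
    ((A xor ((p xor d) ∧ (p′ xor d′)))
      xor (((p xor q) xor d) ∧ ((p′ xor q′) xor d′)))
      xor ((q xor d) ∧ (q′ xor d′))
    ≡ (A xor ((p ∧ q′) xor (q ∧ p′))) xor (d ∧ d′)
  expand = solve 7 (λ A p q d p′ q′ d′ →
    ((A :+ ((p :+ d) :* (p′ :+ d′)))
      :+ (((p :+ q) :+ d) :* ((p′ :+ q′) :+ d′)))
      :+ ((q :+ d) :* (q′ :+ d′))
    := (A :+ ((p :* q′) :+ (q :* p′))) :+ (d :* d′)) refl

  entries : ∀ x y → adj H x y ≡ adj G x y xor ((p x ∧ q y) xor (q x ∧ p y))
  entries x y = by-cases (x ≟ y)
    where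
    formula : ∀ {d} → d ≡ true → x ≢ y →
      ((adj G x y xor (d ∧ (adj G u x ∧ adj G u y)))
        xor (d ∧ (adj (G * u) v x ∧ adj (G * u) v y)))
        xor (d ∧ (adj ((G * u) * v) u x ∧ adj ((G * u) * v) u y))
      ≡ adj G x y xor ((p x ∧ q y) xor (q x ∧ p y))
    formula refl x≢y = begin
      ((adj G x y xor (adj G u x ∧ adj G u y))
        xor (adj (G * u) v x ∧ adj (G * u) v y))
        xor (adj ((G * u) * v) u x ∧ adj ((G * u) * v) u y)
          ≡⟨ cong₂ _xor_
               (cong₂ _xor_
                 (cong (adj G x y xor_) (cong₂ _∧_ (row₀-u x) (row₀-u y)))
                 (cong₂ _∧_ (row₁-v x) (row₁-v y)))
               (cong₂ _∧_ (row₂-u x) (row₂-u y)) ⟩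
      ((adj G x y xor ((p x xor δ u x) ∧ (p y xor δ u y)))
        xor (((p x xor q x) xor δ u x) ∧ ((p y xor q y) xor δ u y)))
        xor ((q x xor δ u x) ∧ (q y xor δ u y))
          ≡⟨ expand (adj G x y) (p x) (q x) (δ u x) (p y) (q y) (δ u y) ⟩
      (adj G x y xor ((p x ∧ q y) xor (q x ∧ p y))) xor (δ u x ∧ δ u y)
          ≡⟨ cong ((adj G x y xor ((p x ∧ q y) xor (q x ∧ p y))) xor_) (both-u x≢y) ⟩
      (adj G x y xor ((p x ∧ q y) xor (q x ∧ p y))) xor false
          ≡⟨ xor-identityʳ _ ⟩
      adj G x y xor ((p x ∧ q y) xor (q x ∧ p y)) ∎

    by-cases : Dec (x ≡ y) →
      adj H x y ≡ adj G x y xor ((p x ∧ q y) xor (q x ∧ p y))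
    by-cases (no x≢y)   = formula (cong not (δ-≢ x≢y)) x≢y
    by-cases (yes refl) = begin
      adj H x x                                    ≡⟨ adj-irrefl H x ⟩
      false                                        ≡⟨ solve 2 (λ a b → con false := con false :+ (a :* b :+ b :* a)) refl (p x) (q x) ⟩
      false xor ((p x ∧ q x) xor (q x ∧ p x))      ≡⟨ cong (_xor ((p x ∧ q x) xor (q x ∧ p x))) (adj-irrefl G x) ⟨
      adj G x x xor ((p x ∧ q x) xor (q x ∧ p x))  ∎

-- The action of a pivot on vectors

infix 9 _·_

_·_ : Graph n → (Fin n → Bool) → Fin n → Bool
(G · x) v = adj G v ∙ x

-- Modulo 2, adding a + b to both a and b exchanges them. So one shift, supported on u and v, serves
-- for both x and A x.
pivotShift : Graph n → Fin n → Fin n → (Fin n → Bool) → Fin n → Bool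
pivotShift G u v x w =
  (((G · x) u xor x u) ∧ δ u w) xor (((G · x) v xor x v) ∧ δ v w)

-- Exchanges the coordinates x and A x at u and at v.
pivotVector : Graph n → Fin n → Fin n → (Fin n → Bool) → Fin n → Bool
pivotVector G u v x w = x w xor pivotShift G u v x w

-- With α = p ∙ x and β = q ∙ x, the new matrix sends x to A x + β p + α q and the shift to α (q + δ
-- u) + β (p + δ v). The multiples of p and q cancel.
·-pivotVector : {G H : Graph n} {u v : Fin n} → PivotRelated G H u v →
                ∀ x w → (H · pivotVector G u v x) w ≡ (G · x) w xor pivotShift G u v x w
·-pivotVector {n} {G} {H} {u} {v} r x w = begin
  adj H w ∙ pivotVector G u v x
    ≡⟨ ∙-distribˡ (adj H w) x (pivotShift G u v x) ⟩
  adj H w ∙ x xor adj H w ∙ pivotShift G u v x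
    ≡⟨ cong₂ _xor_ image-x image-shift ⟩
  ((G · x) w xor ((p w ∧ β) xor (q w ∧ α)))
    xor ((α ∧ (q w xor δ u w)) xor (β ∧ (p w xor δ v w)))
    ≡⟨ simplify ((G · x) w) (p w) (q w) α β (δ u w) (δ v w) ⟩
  (G · x) w xor pivotShift G u v x w ∎
  where
  open PivotRelated r
  open xor-∧-Solver
  α β : Bool
  α = (G · x) u xor x u
  β = (G · x) v xor x v

  simplify : ∀ y p q α β d e →
    (y xor ((p ∧ β) xor (q ∧ α))) xor ((α ∧ (q xor d)) xor (β ∧ (p xor e)))
    ≡ y xor ((α ∧ d) xor (β ∧ e))
  simplify = solve 7 (λ y p q α β d e →
    (y :+ ((p :* β) :+ (q :* α))) :+ ((α :* (q :+ d)) :+ (β :* (p :+ e)))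
    := y :+ ((α :* d) :+ (β :* e))) refl

  closed-∙ : ∀ (f : Fin n → Bool) z → (∀ i → adj G z i ≡ f i xor δ z i) →
             f ∙ x ≡ (G · x) z xor x z
  closed-∙ f z row = begin
    f ∙ x                               ≡⟨ ∙-congˡ x (λ i → trans (xor-twice (f i) (δ z i)) (cong (_xor δ z i) (sym (row i)))) ⟩
    (λ i → adj G z i xor δ z i) ∙ x     ≡⟨ ∙-distribʳ x (adj G z) (δ z) ⟩
    (G · x) z xor δ z ∙ x               ≡⟨ cong ((G · x) z xor_) (trans (∙-comm (δ z) x) (∙-δ x z)) ⟩
    (G · x) z xor x z                   ∎

  image-x : adj H w ∙ x ≡ (G · x) w xor ((p w ∧ β) xor (q w ∧ α))
  image-x = begin
    adj H w ∙ x
      ≡⟨ ∙-congˡ x (entries w) ⟩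
    (λ i → adj G w i xor ((p w ∧ q i) xor (q w ∧ p i))) ∙ x
      ≡⟨ ∙-distribʳ x (adj G w) (λ i → (p w ∧ q i) xor (q w ∧ p i)) ⟩
    (G · x) w xor (λ i → (p w ∧ q i) xor (q w ∧ p i)) ∙ x
      ≡⟨ cong ((G · x) w xor_) (∙-distribʳ x (λ i → p w ∧ q i) (λ i → q w ∧ p i)) ⟩
    (G · x) w xor ((λ i → p w ∧ q i) ∙ x xor (λ i → q w ∧ p i) ∙ x)
      ≡⟨ cong ((G · x) w xor_) (cong₂ _xor_ (∙-scaleˡ (p w) q x) (∙-scaleˡ (q w) p x)) ⟩
    (G · x) w xor ((p w ∧ q ∙ x) xor (q w ∧ p ∙ x))
      ≡⟨ cong ((G · x) w xor_) (cong₂ (λ a b → (p w ∧ a) xor (q w ∧ b)) (closed-∙ q v rowᴳ-v) (closed-∙ p u rowᴳ-u)) ⟩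
    (G · x) w xor ((p w ∧ β) xor (q w ∧ α)) ∎

  image-shift : adj H w ∙ pivotShift G u v x ≡ (α ∧ (q w xor δ u w)) xor (β ∧ (p w xor δ v w))
  image-shift = begin
    adj H w ∙ pivotShift G u v x
      ≡⟨ ∙-distribˡ (adj H w) (λ i → α ∧ δ u i) (λ i → β ∧ δ v i) ⟩
    adj H w ∙ (λ i → α ∧ δ u i) xor adj H w ∙ (λ i → β ∧ δ v i)
      ≡⟨ cong₂ _xor_ (∙-scaleʳ α (adj H w) (δ u)) (∙-scaleʳ β (adj H w) (δ v)) ⟩
    (α ∧ adj H w ∙ δ u) xor (β ∧ adj H w ∙ δ v)
      ≡⟨ cong₂ (λ a b → (α ∧ a) xor (β ∧ b))
           (trans (∙-δ (adj H w) u) (trans (adj-sym H w u) (rowᴴ-u w)))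
           (trans (∙-δ (adj H w) v) (trans (adj-sym H w v) (rowᴴ-v w))) ⟩
    (α ∧ (q w xor δ u w)) xor (β ∧ (p w xor δ v w)) ∎

-- Certificates

coord : Graph n → (side : Fin n → Bool) → (Fin n → Bool) → Fin n → Bool
coord G side x v = if side v then (G · x) v else x v

infix 4 _∉_

_∉_ : Fin n → (Fin t → Fin n) → Set
v ∉ e = ∀ i → e i ≢ v

-- Deleting the vertices outside place with side false, and contracting those
-- with side true, leaves tP₁: the surviving coordinates vanish on the whole
-- Lagrangian space of the minor. A vertex in place with side false records
-- that the pivots leading to the minor involve it an odd number of times.
record Certificate (t : ℕ) (G : Graph n) : Set where
  field
    side      : Fin n → Bool
    place     : Fin t → Fin n
    injective : ∀ {i j} → place i ≡ place j → i ≡ j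
    vanishing : ∀ x → (∀ v → v ∉ place → coord G side x v ≡ false) →
                ∀ v → coord G side x v ≡ false

flip : Fin n → Fin n → (Fin n → Bool) → Fin n → Bool
flip u v side w = side w xor (δ u w xor δ v w)

-- The exchange of coordinates at u and v is compensated by changing the side there. As u and v
-- differ, no vertex is flipped twice.
coord-pivotVector : {G H : Graph n} {u v : Fin n} → PivotRelated G H u v →
                    ∀ side x w → coord H side (pivotVector G u v x) w ≡ coord G (flip u v side) x w
coord-pivotVector {G = G} {H} {u} {v} r side x w = begin
  coord H side (pivotVector G u v x) w
    ≡⟨ cong (λ y → if side w then y else pivotVector G u v x w) (·-pivotVector r x w) ⟩
  (if side w then (G · x) w xor pivotShift G u v x w else x w xor pivotShift G u v x w)
    ≡⟨ exchange (side w) (u ≟ w) (v ≟ w) ((G · x) w) (x w)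
         {(G · x) u xor x u} {(G · x) v xor x v} (λ { refl → refl }) (λ { refl → refl }) ⟩
  coord G (flip u v side) x w ∎
  where
  absorb : ∀ a b → a xor (a xor b) ≡ b
  absorb = solve 2 (λ a b → a :+ (a :+ b) := b) refl
    where open xor-∧-Solver

  shiftˡ : ∀ b y x {α} β → α ≡ y xor x →
    (if b then y xor ((α ∧ true) xor (β ∧ false)) else x xor ((α ∧ true) xor (β ∧ false)))
    ≡ (if b xor true then y else x)
  shiftˡ b y x β refl rewrite ∧-zeroʳ β | ∧-identityʳ (y xor x) | xor-identityʳ (y xor x) with b
  ... | true  = absorb y x
  ... | false = trans (cong (x xor_) (xor-comm y x)) (absorb x y)

  exchange : ∀ b (d : Dec (u ≡ w)) (e : Dec (v ≡ w)) y x {α β} →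
    (u ≡ w → α ≡ y xor x) → (v ≡ w → β ≡ y xor x) →
    (if b then y xor ((α ∧ does d) xor (β ∧ does e)) else x xor ((α ∧ does d) xor (β ∧ does e)))
    ≡ (if b xor (does d xor does e) then y else x)
  exchange b (yes refl) (yes v≡u) y x _ _ = contradiction (sym v≡u) (PivotRelated.u≢v r)
  exchange b (yes u≡w)  (no _)    y x {β = β} α≡ _ = shiftˡ b y x β (α≡ u≡w)
  exchange b (no _)     (yes v≡w) y x {α} {β} _ β≡ = begin
    (if b then y xor ((α ∧ false) xor (β ∧ true)) else x xor ((α ∧ false) xor (β ∧ true)))
      ≡⟨ cong (λ c → if b then y xor c else x xor c) (xor-comm (α ∧ false) (β ∧ true)) ⟩
    (if b then y xor ((β ∧ true) xor (α ∧ false)) else x xor ((β ∧ true) xor (α ∧ false)))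
      ≡⟨ shiftˡ b y x α (β≡ v≡w) ⟩
    (if b xor true then y else x) ∎
  exchange b (no _)     (no _)    y x {α} {β} _ _
    rewrite ∧-zeroʳ α | ∧-zeroʳ β | xor-identityʳ y | xor-identityʳ x | xor-identityʳ b = refl

-- A vector x for H is pivoted back to G, where it has the same chosen coordinates, so the vanishing
-- condition carries over with the same places.
Certificate-pivot : {G H : Graph n} {u v : Fin n} → PivotRelated G H u v →
                    Certificate t G → Certificate t H
Certificate-pivot {G = G} {H} {u} {v} r c = record
  { side      = flip u v side
  ; place     = place
  ; injective = injective
  ; vanishing = λ x off w → trans (sym (transfer x w))
      (vanishing (pivotVector H u v x) (λ z z∉ → trans (transfer x z) (off z z∉)) w)
  }
  where
  open Certificate c
  transfer : ∀ x w → coord G side (pivotVector H u v x) w ≡ coord H (flip u v side) x w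
  transfer = coord-pivotVector (PivotRelated-sym r) side

-- Vectors on `G - v` extend by zero at v, and `deletable` makes the chosen coordinate at v vanish
-- on them. This covers both a vertex of side false and an isolated vertex of side true.
Certificate-delete : {G : Graph (suc n)} (c : Certificate t G) (v : Fin (suc n)) →
                     v ∉ Certificate.place c →
                     (∀ x → x v ≡ false → coord G (Certificate.side c) x v ≡ false) →
                     Certificate t (G - v)
Certificate-delete {n} {t} {G} c v v∉ deletable = record
  { side      = side ∘ punchIn v
  ; place     = place′
  ; injective = λ eq → injective (punchOut-injective (v≢ _) (v≢ _) eq)
  ; vanishing = λ x off w → trans (sym (coord-extend x w)) (vanishing (extend x) (off′ x off) (punchIn v w))
  }
  where
  open Certificate c
  v≢ : ∀ i → v ≢ place i
  v≢ i = v∉ i ∘ sym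
  place′ : Fin t → Fin n
  place′ i = punchOut (v≢ i)
  extend : (Fin n → Bool) → Fin (suc n) → Bool
  extend x = insertAt x v false

  ·-extend : ∀ x w → (G · extend x) (punchIn v w) ≡ ((G - v) · x) w
  ·-extend x w = begin
    (G · extend x) v′                                              ≡⟨ sum-remove {i = v} (λ z → adj G v′ z ∧ extend x z) ⟩
    (adj G v′ v ∧ extend x v) xor adj G v′ ∘ punchIn v ∙ (extend x ∘ punchIn v)
      ≡⟨ cong₂ _xor_ (trans (cong (adj G v′ v ∧_) (insertAt-lookup x v false)) (∧-zeroʳ (adj G v′ v)))
           (sum-cong-≗ (λ z → cong (adj G v′ (punchIn v z) ∧_) (insertAt-punchIn x v false z))) ⟩
    ((G - v) · x) w ∎
    where v′ = punchIn v w

  coord-extend : ∀ x w → coord G side (extend x) (punchIn v w) ≡ coord (G - v) (side ∘ punchIn v) x w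
  coord-extend x w = cong₂ (λ y z → if side (punchIn v w) then y else z)
    (·-extend x w) (insertAt-punchIn x v false w)

  off′ : ∀ x → (∀ w → w ∉ place′ → coord (G - v) (side ∘ punchIn v) x w ≡ false) →
         ∀ w → w ∉ place → coord G side (extend x) w ≡ false
  off′ x off w w∉ with v ≟ w
  ... | yes refl = deletable (extend x) (insertAt-lookup x v false)
  ... | no v≢w = subst (λ z → coord G side (extend x) z ≡ false) (punchIn-punchOut v≢w)
    (trans (coord-extend x (punchOut v≢w)) (off (punchOut v≢w) λ i eq → w∉ i (punchOut-injective (v≢ i) v≢w eq)))

coord-false : (G : Graph n) (side : Fin n → Bool) (x : Fin n → Bool) {v : Fin n} →
              side v ≡ false → coord G side x v ≡ x v
coord-false G side x {v} eq = cong (λ b → if b then (G · x) v else x v) eq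

coord-true : (G : Graph n) (side : Fin n → Bool) (x : Fin n → Bool) {v : Fin n} →
             side v ≡ true → coord G side x v ≡ (G · x) v
coord-true G side x {v} eq = cong (λ b → if b then (G · x) v else x v) eq

Certificate-minus : {G : Graph n} (c : Certificate t G) (v : Fin n) →
                    v ∉ Certificate.place c → Certificate.side c v ≡ false →
                    Certificate t (G - v)
Certificate-minus {n = suc _} {G = G} c v v∉ eq =
  Certificate-delete c v v∉ (λ x xv≡0 → trans (coord-false G (Certificate.side c) x eq) xv≡0)

-- The pivot on z and v turns the side of v from true to false, which reduces contraction to
-- deletion. If v is isolated, (A x)_v is always zero and v can be deleted directly.
Certificate-slash : {G : Graph n} (c : Certificate t G) (v : Fin n) →
                    v ∉ Certificate.place c → Certificate.side c v ≡ true →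
                    Certificate t (G / v)
Certificate-slash {n = suc _} {G = G} c v v∉ eq with any? (λ z → T? (adj G z v))
... | yes (z , zv) =
  Certificate-minus (Certificate-pivot (pivotRelated G z v zv≡true) c) v v∉
    (cong₂ _xor_ eq (cong₂ _xor_ (δ-≢ (edge⇒≢ G zv≡true)) (δ-refl v)))
  where zv≡true = Equivalence.to T-≡ zv
... | no isolated = Certificate-delete c v v∉ λ x _ →
  trans (coord-true G (Certificate.side c) x eq) (sum-zero _ λ z → cong (_∧ x z) (non-neighbour z))
  where
  non-neighbour : ∀ z → adj G v z ≡ false
  non-neighbour z = ¬-not λ vz → isolated (z , Equivalence.from T-≡ (trans (adj-sym G z v) vz))

-- From certificates to pivot-minors

module _ {H : Graph m} where

  containsPivotMinor-delete : (G : Graph n) (v : Fin n) →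
    (G - v) ContainsPivotMinor H → G ContainsPivotMinor H
  containsPivotMinor-delete G v (k , K , minor , iso) = k , K , delete v minor , iso

  containsPivotMinor-slash : (G : Graph n) (v : Fin n) →
    (G / v) ContainsPivotMinor H → G ContainsPivotMinor H
  containsPivotMinor-slash G v contains with any? (λ z → T? (adj G z v)) | contains
  ... | yes (z , zv) | k , K , minor , iso = k , K , pivotOn z v zv (delete v minor) , iso
  ... | no _         | k , K , minor , iso = k , K , delete v minor , iso

_∈?_ : (v : Fin n) (e : Fin t → Fin n) → Dec (∃ λ i → e i ≡ v)
v ∈? e = any? (λ i → e i ≟ v)

-- With no vertex outside the places, every chosen coordinate of every vector vanishes. Side false
-- at v would contradict this for the unit vector `δ v`, so all sides are true and A kills every
-- unit vector.
total-certificate⇒≅ : {G : Graph n} (c : Certificate t G) →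
  (∀ v → ∃ λ i → Certificate.place c i ≡ v) → G ≅ (t P₁)
total-certificate⇒≅ {n} {t} {G} c onto = record
  { bijection = mk↔ₛ′ (λ v → proj₁ (onto v)) place
      (λ i → injective (proj₂ (onto (place i)))) (λ v → proj₂ (onto v))
  ; preserves = edgeless
  }
  where
  open Certificate c
  all-vanish : ∀ x v → coord G side x v ≡ false
  all-vanish x = vanishing x λ v v∉ → contradiction (proj₂ (onto v)) (v∉ _)

  side-true : ∀ v → side v ≡ true
  side-true v = ¬-not λ eq → contradiction
    (trans (sym (δ-refl v)) (trans (sym (coord-false G side (δ v) eq)) (all-vanish (δ v) v))) λ ()

  edgeless : ∀ v w → adj G v w ≡ false
  edgeless v w = begin
    adj G v w         ≡⟨ ∙-δ (adj G v) w ⟨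
    (G · δ w) v       ≡⟨ coord-true G side (δ w) (side-true v) ⟨
    coord G side (δ w) v ≡⟨ all-vanish (δ w) v ⟩
    false             ∎

-- Induction on the number of vertices: a vertex outside the places is deleted or contracted as its
-- side dictates, and the certificate restricts.
certificate⇒contains : (G : Graph n) → Certificate t G → G ContainsPivotMinor (t P₁)
certificate⇒contains {n} G c with all? (_∈? Certificate.place c)
... | yes onto = n , G , done , total-certificate⇒≅ c onto
certificate⇒contains {suc n} G c | no ¬onto
  with v , v∉ ← ¬∀⟶∃¬ (suc n) _ (_∈? Certificate.place c) ¬onto
  with Certificate.side c v in eq
... | false = containsPivotMinor-delete G v
  (certificate⇒contains {n} (G - v) (Certificate-minus c v (λ i p → v∉ (i , p)) eq))
... | true  = containsPivotMinor-slash G v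
  (certificate⇒contains {n} (G / v) (Certificate-slash c v (λ i p → v∉ (i , p)) eq))
certificate⇒contains {zero} G c | no ¬onto = contradiction (λ ()) ¬onto

-- Unambiguous graphs

-- Phrased through certificates so that invariance under pivots needs no comparison of the graphs
-- `G - v` and `G / v` before and after a pivot.
Unambiguous : ℕ → Graph n → Set
Unambiguous t G = ∀ (c c′ : Certificate t G) {v} →
  v ∉ Certificate.place c → v ∉ Certificate.place c′ →
  Certificate.side c v ≡ false → ¬ Certificate.side c′ v ≡ true

pivotUnique⇒unambiguous : {G : Graph n} → (t P₁) -PivotUnique G → Unambiguous t G
pivotUnique⇒unambiguous {G = G} (_ , unique) c c′ {v} v∉ v∉′ deleted contracted = unique v
  ( certificate⇒contains (G - v) (Certificate-minus c v v∉ deleted)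
  , certificate⇒contains (G / v) (Certificate-slash c′ v v∉′ contracted) )

-- Both certificates are pulled back to G. If w is u or v, both sides at w flip and the two
-- certificates exchange roles.
unambiguous-pivot : {G H : Graph n} {u v : Fin n} → PivotRelated G H u v →
                    Unambiguous t G → Unambiguous t H
unambiguous-pivot {G = G} {H} {u} {v} r unambiguous c c′ {w} w∉ w∉′ eq eq′
  with δ u w xor δ v w in flipped
... | false = unambiguous (back c) (back c′) w∉ w∉′ (cong₂ _xor_ eq flipped) (cong₂ _xor_ eq′ flipped)
  where back = Certificate-pivot (PivotRelated-sym r)
... | true  = unambiguous (back c′) (back c) w∉′ w∉ (cong₂ _xor_ eq′ flipped) (cong₂ _xor_ eq flipped)
  where back = Certificate-pivot (PivotRelated-sym r)

-- Induced subgraphs under pivots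

Injective : (Fin m → Fin n) → Set
Injective e = ∀ {i j} → e i ≡ e j → i ≡ j

Embeds : Graph m → Graph n → (Fin m → Fin n) → Set
Embeds H G e = ∀ x y → adj H x y ≡ adj G (e x) (e y)

distinct-injective : {e : Fin m → Fin n} → Injective e →
                     ∀ x y → distinct x y ≡ distinct (e x) (e y)
distinct-injective {e = e} inj x y = cong not (does-⇔ (mk⇔ (cong e) inj) (x ≟ y) (e x ≟ e y))

embeds-* : (H : Graph m) (G : Graph n) {e : Fin m → Fin n} → Injective e →
           Embeds H G e → ∀ u → Embeds (H * u) (G * e u) e
embeds-* H G inj emb u x y = cong₂ _xor_ (emb x y)
  (cong₂ _∧_ (distinct-injective inj x y) (cong₂ _∧_ (emb u x) (emb u y)))

-- The ambient graph keeps all n original vertices, so a bound on its size bounds the original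
-- graph.
record Spans (t : ℕ) (K : Graph m) (n : ℕ) : Set where
  field
    graph       : Graph n
    unambiguous : Unambiguous t graph
    embedding   : Fin m → Fin n
    injective   : Injective embedding
    embeds      : Embeds K graph embedding

-- All deletions can be postponed until after the pivots.
pivotMinor⇒spans : {k : ℕ} {K : Graph k} {H : Graph m} → K IsPivotMinorOf H →
  (G : Graph n) → Unambiguous t G →
  (e : Fin m → Fin n) → Injective e → Embeds H G e → Spans t K n
pivotMinor⇒spans done G un e inj emb = record
  { graph = G ; unambiguous = un ; embedding = e ; injective = inj ; embeds = emb }
pivotMinor⇒spans {m = suc _} (delete v minor) G un e inj emb =
  pivotMinor⇒spans minor G un (e ∘ punchIn v)
    (λ eq → punchIn-injective v _ _ (inj eq)) (λ x y → emb (punchIn v x) (punchIn v y))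
pivotMinor⇒spans {H = H} (pivotOn u v uv minor) G un e inj emb =
  pivotMinor⇒spans minor (pivot G (e u) (e v))
    (unambiguous-pivot (pivotRelated G (e u) (e v) (trans (sym (emb u v)) (Equivalence.to T-≡ uv))) un)
    e inj
    (embeds-* ((H * u) * v) ((G * e u) * e v) inj
      (embeds-* (H * u) (G * e u) inj (embeds-* H G inj emb u) v) u)

-- Neighbourhoods in an independent set

module IndependentSet {G : Graph n} {e : Fin t → Fin n} (inj : Injective e)
  (independent : ∀ i j → adj G (e i) (e j) ≡ false) where

  private
    X : Fin n → Bool
    X v = does (v ∈? e)

    X-in : ∀ i → X (e i) ≡ true
    X-in i = dec-true (e i ∈? e) (i , refl)

    X-out : ∀ {v} → v ∉ e → X v ≡ false
    X-out v∉ = dec-false (_ ∈? e) λ (i , eq) → v∉ i eq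

  certificate : (side : Fin n → Bool) (place : Fin t → Fin n) → Injective place →
    (∀ x → (∀ v → v ∉ place → coord G side x v ≡ false) →
           ∀ i → coord G side x (place i) ≡ false) →
    Certificate t G
  certificate side place place-inj vanish = record
    { side = side ; place = place ; injective = place-inj
    ; vanishing = λ x off v → by-cases x off v (v ∈? place) }
    where
    by-cases : ∀ x → (∀ v → v ∉ place → coord G side x v ≡ false) →
               ∀ v → Dec (∃ λ i → place i ≡ v) → coord G side x v ≡ false
    by-cases x off v (yes (i , refl)) = vanish x off i
    by-cases x off v (no v∉)          = off v (λ i eq → v∉ (i , eq))

  row-zero : (x : Fin n → Bool) (i : Fin t) →
             (∀ z → z ∉ e → adj G (e i) z ∧ x z ≡ false) → (G · x) (e i) ≡ false
  row-zero x i off = sum-zero _ λ z → term z (z ∈? e)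
    where
    term : ∀ z → Dec (∃ λ j → e j ≡ z) → adj G (e i) z ∧ x z ≡ false
    term z (yes (j , refl)) = cong (_∧ x z) (independent i j)
    term z (no z∉)          = off z (λ j eq → z∉ (j , eq))

  -- Outside the set the chosen coordinate is x itself. Once x vanishes there, independence makes A
  -- x vanish on the set.
  deletion : Certificate t G
  deletion = certificate X e inj λ x off i → trans (coord-true G X x (X-in i))
    (row-zero x i λ z z∉ → trans
      (cong (adj G (e i) z ∧_) (trans (sym (coord-false G X x (X-out z∉))) (off z z∉)))
      (∧-zeroʳ _))

  module _ {v : Fin n} (v∉ : v ∉ e) where

    -- Contracting v leaves x v unconstrained, but x v has coefficient zero in each row of the set.
    contraction-isolated : (∀ i → adj G (e i) v ≡ false) → Certificate t G
    contraction-isolated v≁ = certificate side e inj λ x off i →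
      trans (coord-true G side x (cong (_∨ δ v (e i)) (X-in i)))
        (row-zero x i λ z z∉ → term x off i z z∉ (v ≟ z))
      where
      side : Fin n → Bool
      side w = X w ∨ δ v w
      term : ∀ x → (∀ z → z ∉ e → coord G side x z ≡ false) →
             ∀ i z → z ∉ e → Dec (v ≡ z) → adj G (e i) z ∧ x z ≡ false
      term x off i z z∉ (yes refl) = cong (_∧ x v) (v≁ i)
      term x off i z z∉ (no v≢z)   = trans
        (cong (adj G (e i) z ∧_) (trans
          (sym (coord-false G side x (cong₂ _∨_ (X-out z∉) (δ-≢ v≢z)))) (off z z∉)))
        (∧-zeroʳ _)

    -- If v has the single neighbour e k in the set, then pivoting on v and e k
    -- keeps the set independent; this is recorded by changing the side of e k.
    contraction-pendant : (k : Fin t) → (∀ i → adj G (e i) v ≡ δ (e i) (e k)) → Certificate t G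
    contraction-pendant k v~k = certificate side e inj vanish
      where
      side : Fin n → Bool
      side w = (X w ∧ not (δ w (e k))) ∨ δ v w

      module _ (x : Fin n → Bool) (off : ∀ z → z ∉ e → coord G side x z ≡ false) where

        outside : ∀ z → z ∉ e → v ≢ z → x z ≡ false
        outside z z∉ v≢z = trans
          (sym (coord-false G side x (cong₂ _∨_ (cong (_∧ not (δ z (e k))) (X-out z∉)) (δ-≢ v≢z))))
          (off z z∉)

        only-k : ∀ z → e k ≢ z → Dec (∃ λ j → e j ≡ z) → Dec (v ≡ z) → adj G v z ∧ x z ≡ false
        only-k z k≢z (yes (j , refl)) _ =
          cong (_∧ x z) (trans (adj-sym G v z) (trans (v~k j) (δ-≢ (k≢z ∘ sym))))
        only-k z k≢z (no z∉) (yes refl) = cong (_∧ x z) (adj-irrefl G v)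
        only-k z k≢z (no z∉) (no v≢z) = trans
          (cong (adj G v z ∧_) (outside z (λ j eq → z∉ (j , eq)) v≢z)) (∧-zeroʳ _)

        -- As v is contracted, (A x)_v is zero, and its only surviving term is x at `e k`, the
        -- coordinate chosen there.
        x-k : x (e k) ≡ false
        x-k = begin
          x (e k)                  ≡⟨ cong (_∧ x (e k)) (trans (v~k k) (δ-refl (e k))) ⟨
          adj G (e k) v ∧ x (e k)  ≡⟨ cong (_∧ x (e k)) (adj-sym G (e k) v) ⟩
          adj G v (e k) ∧ x (e k)  ≡⟨ sum-single _ (e k) (λ z k≢z → only-k z k≢z (z ∈? e) (v ≟ z)) ⟨
          (G · x) v                ≡⟨ coord-true G side x (cong₂ _∨_ (cong (_∧ not (δ v (e k))) (X-out v∉)) (δ-refl v)) ⟨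
          coord G side x v         ≡⟨ off v v∉ ⟩
          false                    ∎

        term : ∀ i → e i ≢ e k → ∀ z → z ∉ e → Dec (v ≡ z) → adj G (e i) z ∧ x z ≡ false
        term i i≢k z z∉ (yes refl) = cong (_∧ x v) (trans (v~k i) (δ-≢ i≢k))
        term i i≢k z z∉ (no v≢z)   = trans (cong (adj G (e i) z ∧_) (outside z z∉ v≢z)) (∧-zeroʳ _)

        vanish : ∀ i → coord G side x (e i) ≡ false
        vanish i = by-cases (e i ≟ e k)
          where
          by-cases : Dec (e i ≡ e k) → coord G side x (e i) ≡ false
          by-cases (yes eq) = subst (λ z → coord G side x z ≡ false) (sym eq)
            (trans (coord-false G side x (cong₂ _∨_ (cong₂ (λ a b → a ∧ not b) (X-in k) (δ-refl (e k))) (δ-≢ (v∉ k ∘ sym)))) x-k)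
          by-cases (no i≢k) = trans
            (coord-true G side x (cong₂ (λ a b → (a ∧ not b) ∨ δ v (e i)) (X-in i) (δ-≢ i≢k)))
            (row-zero x i λ z z∉ → term i i≢k z z∉ (v ≟ z))

    -- Pivoting on v and e k makes w independent of the rest of the set, so that
    -- w can replace e k once v and e k are contracted in G.
    contraction-twin : {w : Fin n} → w ∉ e → v ≢ w →
      (∀ i → adj G (e i) v ≡ adj G (e i) w) → (k : Fin t) → adj G (e k) v ≡ true →
      Σ (Certificate t G) λ c → v ∉ Certificate.place c × Certificate.side c v ≡ true
    contraction-twin {w} w∉ v≢w twins k k~v =
      certificate side place place-inj vanish , v∉place , side-v
      where
      side : Fin n → Bool
      side z = X z ∨ (δ v z ∨ δ w z)
      place : Fin t → Fin n
      place i = if δ i k then w else e i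

      side-e : ∀ i → side (e i) ≡ true
      side-e i = cong (_∨ (δ v (e i) ∨ δ w (e i))) (X-in i)
      side-v : side v ≡ true
      side-v = cong₂ _∨_ (X-out v∉) (cong (_∨ δ w v) (δ-refl v))
      side-w : side w ≡ true
      side-w = cong₂ _∨_ (X-out w∉) (cong₂ _∨_ (δ-≢ v≢w) (δ-refl w))

      v∉place : v ∉ place
      v∉place i eq with i ≟ k
      ... | yes _ = v≢w (sym eq)
      ... | no _  = v∉ i eq

      k∉place : e k ∉ place
      k∉place i eq with i ≟ k
      ... | yes _  = w∉ k (sym eq)
      ... | no i≢k = i≢k (inj eq)

      off-place : ∀ {z} → z ∉ e → w ≢ z → z ∉ place
      off-place z∉ w≢z i eq with i ≟ k
      ... | yes _ = w≢z eq
      ... | no _  = z∉ i eq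

      place-inj : Injective place
      place-inj {i} {j} eq with i ≟ k | j ≟ k
      ... | yes refl | yes refl = refl
      ... | yes _    | no  _    = contradiction (sym eq) (w∉ j)
      ... | no  _    | yes _    = contradiction eq (w∉ i)
      ... | no  _    | no  _    = inj eq

      module _ (x : Fin n → Bool) (off : ∀ z → z ∉ place → coord G side x z ≡ false) where

        outside : ∀ z → z ∉ e → v ≢ z → w ≢ z → x z ≡ false
        outside z z∉ v≢z w≢z = trans
          (sym (coord-false G side x (cong₂ _∨_ (X-out z∉) (cong₂ _∨_ (δ-≢ v≢z) (δ-≢ w≢z)))))
          (off z (off-place z∉ w≢z))

        supported : (f : Fin n → Bool) → (∀ i → f (e i) ≡ false) →
                    f ∙ x ≡ (f v ∧ x v) xor (f w ∧ x w)
        supported f f-e = sum-pair _ v≢w λ z v≢z w≢z → term z v≢z w≢z (z ∈? e)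
          where
          term : ∀ z → v ≢ z → w ≢ z → Dec (∃ λ i → e i ≡ z) → f z ∧ x z ≡ false
          term z v≢z w≢z (yes (i , refl)) = cong (_∧ x z) (f-e i)
          term z v≢z w≢z (no z∉) = trans
            (cong (f z ∧_) (outside z (λ i eq → z∉ (i , eq)) v≢z w≢z)) (∧-zeroʳ _)

        row-e : ∀ i → (G · x) (e i) ≡ adj G (e i) v ∧ (x v xor x w)
        row-e i = begin
          (G · x) (e i)                                        ≡⟨ supported (adj G (e i)) (independent i) ⟩
          (adj G (e i) v ∧ x v) xor (adj G (e i) w ∧ x w)      ≡⟨ cong (λ a → (adj G (e i) v ∧ x v) xor (a ∧ x w)) (twins i) ⟨
          (adj G (e i) v ∧ x v) xor (adj G (e i) v ∧ x w)      ≡⟨ ∧-distribˡ-xor (adj G (e i) v) (x v) (x w) ⟨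
          adj G (e i) v ∧ (x v xor x w)                        ∎

        -- `e k` is no longer a place and has side true, so its row vanishes on x. That row sees
        -- only v and w, with coefficient 1 at both.
        v+w : x v xor x w ≡ false
        v+w = begin
          x v xor x w                    ≡⟨ cong (_∧ (x v xor x w)) k~v ⟨
          adj G (e k) v ∧ (x v xor x w)  ≡⟨ row-e k ⟨
          (G · x) (e k)                  ≡⟨ coord-true G side x (side-e k) ⟨
          coord G side x (e k)           ≡⟨ off (e k) k∉place ⟩
          false                          ∎

        -- The rows of v and w cancel on the set, so their sum involves only x v and x w, each with
        -- coefficient `adj G v w`. As (A x)_v is zero, this yields the vanishing required at the
        -- new place w.
        rows-v+w : (G · x) v xor (G · x) w ≡ false
        rows-v+w = begin
          (G · x) v xor (G · x) w                  ≡⟨ ∙-distribʳ x (adj G v) (adj G w) ⟨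
          (λ z → adj G v z xor adj G w z) ∙ x     
            ≡⟨ supported _ (λ i → trans
                 (cong₂ _xor_ (trans (adj-sym G v (e i)) (twins i)) (adj-sym G w (e i)))
                 (xor-same (adj G (e i) w))) ⟩
          ((adj G v v xor adj G w v) ∧ x v) xor ((adj G v w xor adj G w w) ∧ x w)
            ≡⟨ cong₂ (λ a b → (a ∧ x v) xor (b ∧ x w))
                 (cong₂ _xor_ (adj-irrefl G v) (adj-sym G w v))
                 (trans (cong (adj G v w xor_) (adj-irrefl G w)) (xor-identityʳ (adj G v w))) ⟩
          (adj G v w ∧ x v) xor (adj G v w ∧ x w)  ≡⟨ ∧-distribˡ-xor (adj G v w) (x v) (x w) ⟨
          adj G v w ∧ (x v xor x w)                ≡⟨ cong (adj G v w ∧_) v+w ⟩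
          adj G v w ∧ false                        ≡⟨ ∧-zeroʳ (adj G v w) ⟩
          false                                    ∎

        vanish : ∀ i → coord G side x (place i) ≡ false
        vanish i with i ≟ k
        ... | yes _ = begin
          coord G side x w         ≡⟨ coord-true G side x side-w ⟩
          (G · x) w                ≡⟨ cong (_xor (G · x) w) (trans (sym (coord-true G side x side-v)) (off v v∉place)) ⟨
          (G · x) v xor (G · x) w  ≡⟨ rows-v+w ⟩
          false                    ∎
        ... | no _ = begin
          coord G side x (e i)           ≡⟨ coord-true G side x (side-e i) ⟩
          (G · x) (e i)                  ≡⟨ row-e i ⟩
          adj G (e i) v ∧ (x v xor x w)  ≡⟨ cong (adj G (e i) v ∧_) v+w ⟩
          adj G (e i) v ∧ false          ≡⟨ ∧-zeroʳ (adj G (e i) v) ⟩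
          false                          ∎

  -- Characteristic vector of the closed neighbourhood of v within the set. By independence it is a
  -- singleton for a member of the set, so one formula serves all vertices.
  code : Fin n → Fin t → Bool
  code v i = δ (e i) v xor adj G (e i) v

  code-in : ∀ k i → code (e k) i ≡ δ (e i) (e k)
  code-in k i = trans (cong (δ (e i) (e k) xor_) (independent i k)) (xor-identityʳ _)

  code-out : ∀ {v} → v ∉ e → ∀ i → code v i ≡ adj G (e i) v
  code-out {v} v∉ i = cong (_xor adj G (e i) v) (δ-≢ (v∉ i))

  module _ (unambiguous : Unambiguous t G) where

    code-nonzero : ∀ v → ¬ (∀ i → code v i ≡ false)
    code-nonzero v zero-code with v ∈? e
    ... | yes (k , refl) = contradiction (trans (sym (δ-refl (e k))) (trans (sym (code-in k k)) (zero-code k))) λ ()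
    ... | no v∉e = unambiguous deletion
      (contraction-isolated v∉ λ i → trans (sym (code-out v∉ i)) (zero-code i))
      v∉ v∉ (X-out v∉) (cong₂ _∨_ (X-out v∉) (δ-refl v))
      where v∉ = λ i eq → v∉e (i , eq)

    code-in≢out : ∀ k {v} → v ∉ e → ¬ code (e k) ≗ code v
    code-in≢out k {v} v∉ same = unambiguous deletion
      (contraction-pendant v∉ k λ i → trans (sym (code-out v∉ i)) (trans (sym (same i)) (code-in k i)))
      v∉ v∉ (X-out v∉) (cong₂ _∨_ (cong (_∧ not (δ v (e k))) (X-out v∉)) (δ-refl v))

    code-injective : ∀ {v w} → code v ≗ code w → v ≡ w
    code-injective {v} {w} same with v ≟ w | v ∈? e | w ∈? e
    ... | yes v≡w | _ | _ = v≡w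
    ... | no v≢w | yes (j , refl) | yes (k , refl) = contradiction
      (begin
        true           ≡⟨ δ-refl (e j) ⟨
        δ (e j) (e j)  ≡⟨ code-in j j ⟨
        code (e j) j   ≡⟨ same j ⟩
        code (e k) j   ≡⟨ code-in k j ⟩
        δ (e j) (e k)  ≡⟨ δ-≢ v≢w ⟩
        false          ∎) λ ()
    ... | no v≢w | yes (j , refl) | no w∉ = contradiction same (code-in≢out j λ i eq → w∉ (i , eq))
    ... | no v≢w | no v∉ | yes (k , refl) = contradiction (sym ∘ same) (code-in≢out k λ i eq → v∉ (i , eq))
    -- Twins outside the set: the exchange needs a common neighbour `e k`, which exists because
    -- codes are nonzero.
    ... | no v≢w | no v∉e | no w∉e with any? (λ i → T? (code v i))
    ...   | no none = contradiction (λ i → ¬-not λ eq → none (i , Equivalence.from T-≡ eq)) (code-nonzero v)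
    ...   | yes (k , vk) =
      let c , v∉place , contracted = contraction-twin v∉ w∉ v≢w
            (λ i → trans (sym (code-out v∉ i)) (trans (same i) (code-out w∉ i)))
            k (trans (sym (code-out v∉ k)) (Equivalence.to T-≡ vk))
      in contradiction contracted (unambiguous deletion c v∉ v∉place (X-out v∉))
      where
      v∉ = λ i eq → v∉e (i , eq)
      w∉ = λ i eq → w∉e (i , eq)

    -- The extra element `zero` takes the all-false code, which no vertex has, so the n + 1 codes
    -- are distinct among all 2 ^ t.
    size-bound : suc n ≤ 2 ^ t
    size-bound = injective⇒≤ {f = funToFin ∘ digits} (digits-injective _ _ ∘ funToFin-injective)
      where
      bit : Bool → Fin 2
      bit = Inverse.from 2↔Bool

      bit-injective : ∀ {a b} → bit a ≡ bit b → a ≡ b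
      bit-injective eq = trans (sym (Inverse.strictlyInverseˡ 2↔Bool _))
        (trans (cong (Inverse.to 2↔Bool) eq) (Inverse.strictlyInverseˡ 2↔Bool _))

      digits : Fin (suc n) → Fin t → Fin 2
      digits zero    i = bit false
      digits (suc v) i = bit (code v i)

      funToFin-injective : {f g : Fin t → Fin 2} → funToFin f ≡ funToFin g → f ≗ g
      funToFin-injective {f} {g} eq i = trans (sym (finToFun-funToFin f i))
        (trans (cong (λ z → finToFun z i) eq) (finToFun-funToFin g i))

      digits-injective : ∀ v w → digits v ≗ digits w → v ≡ w
      digits-injective zero    zero    _    = refl
      digits-injective zero    (suc w) same = contradiction (sym ∘ bit-injective ∘ same) (code-nonzero w)
      digits-injective (suc v) zero    same = contradiction (bit-injective ∘ same) (code-nonzero v)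
      digits-injective (suc v) (suc w) same = cong suc (code-injective (bit-injective ∘ same))

theorem4p6 : (t : ℕ) → 1 ≤ t → {n : ℕ} (G : Graph n) →
    (t P₁) -PivotUnique G →
    n ≤ 2 ^ t ∸ 1
theorem4p6 t _ {n} G pu@((k , K , minor , iso) , _) =
  -- After all pivots have been carried out on the full vertex set, the copy of tP₁ is an induced
  -- subgraph; its t vertices form the independent set.
  ∸-monoˡ-≤ 1 (IndependentSet.size-bound {G = graph} {e = embedding ∘ from}
    (from-injective ∘ injective)
    (λ i j → begin
      adj graph (embedding (from i)) (embedding (from j)) ≡⟨ embeds (from i) (from j) ⟨
      adj K (from i) (from j)                             ≡⟨ _≅_.preserves iso (from i) (from j) ⟩
      false                                               ∎)
    unambiguous)
  where
  open Spans (pivotMinor⇒spans minor G (pivotUnique⇒unambiguous pu) (λ v → v) (λ eq → eq) (λ _ _ → refl))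
  open Inverse (_≅_.bijection iso) using (to; from; strictlyInverseˡ)
  from-injective : ∀ {i j} → from i ≡ from j → i ≡ j
  from-injective {i} {j} eq = trans (sym (strictlyInverseˡ i)) (trans (cong to eq) (strictlyInverseˡ j))
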